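{- Let $G$ be a finite simple graph that is prime and contains no induced subgraph isomorphic to $P_5$, $\overline{P_5}$, or $C_5$, and suppose $G$ contains an induced subgraph isomorphic to $\overline{C_4}$. Then there are pairwise disjoint subsets $X_0, X_1, \ldots, X_m, Y_0, Y_1, \ldots, Y_m$ of $V(G)$, with $m\ge 2$, whose union is $V(G)$, such that, writing $X=X_0\cup X_1\cup\cdots\cup X_m$ and $Y=Y_0\cup Y_1\cup\cdots\cup Y_m$, the following hold: (1) For each $i\in\{1,\ldots,m\}$, $G[X_i]$ is connected and $|X_i|\ge 2$; $X_0$ is a (possibly empty) stable set; and $X_0,X_1,\ldots,X_m$ are pairwise anticomplete to each other. (2) For each $i\in\{1,\ldots,m\}$, $Y_i\neq\emptyset$, and every vertex of $Y_i$ is mixed on $X_i$ and complete to $X\setminus(X_i\cup X_0)$; and $Y_0$ is complete to $X\setminus X_0$. (3) $Y_0,Y_1,\ldots,Y_m$ are pairwise complete to each other (so each anticomponent of $Y$ is included in some $Y_i$, $i\in\{0,\ldots,m\}$). (4) No vertex of $X\setminus X_0$ is mixed on any anticomponent of $Y$. (5) For each $i\in\{1,\ldots,m\}$, $X_i$ contains a vertex that is complete to $Y$. (6) Every vertex of $X_0$ is mixed on at most one anticomponent of $Y$. (7) For every big anticomponent $Z$ of $Y$, the set $X_Z$ of vertices of $X_0$ that are mixed on $Z$ is non-empty; moreover, if $Z$ and $Z'$ are two distinct big anticomponents of $Y$, then $X_Z\cap X_{Z'}=\emptyset$. (8) Each big anticomponent $Z$ of $Y$ contains a vertex that is anticomplete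 to $X_Z$. (9) If $Y$ is not a clique, then there is a big anticomponent $Z$ of $Y$ such that $X_Z$ is anticomplete to all big anticomponents of $Y\setminus Z$.
   Context: $P_n$ is the path on $n$ vertices, $C_n$ the cycle on $n$ vertices, $\overline{H}$ the complement of $H$, and $G[S]$ the subgraph induced by $S$. For $S\subseteq V(G)$ and $v\in V(G)\setminus S$: $v$ is complete to $S$ if adjacent to all of $S$, anticomplete to $S$ if adjacent to none of $S$, and mixed on $S$ if neither. Sets $S,T$ disjoint: $S$ is complete (anticomplete) to $T$ if every vertex of $S$ is complete (anticomplete) to $T$. An anticomponent of a set $S\subseteq V(G)$ is a subset of $S$ whose vertex set induces a connected component of $\overline{G}[S]$. A set is big if it has at least two vertices. A homogeneous set is a non-empty $S\subseteq V(G)$ such that every vertex of $V(G)\setminus S$ is complete or anticomplete to $S$; it is proper if $|S|\ge 2$ and $S\ne V(G)$. A graph is prime if it has no proper homogeneous set. -}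

module Defs where

open import Data.Nat using (ℕ; zero; suc; _≤_; _≡ᵇ_)
open import Data.Bool using (Bool; true; false; not; _∧_; _∨_)
open import Data.Fin using (Fin; toℕ)
import Data.Fin as F
open import Data.Fin.Subset using (Subset; _∈_; _∉_)
open import Data.Product using (Σ; ∃; ∃-syntax; _×_; _,_)
open import Data.Sum using (_⊎_)
open import Relation.Nullary using (¬_)
open import Relation.Binary.PropositionalEquality using (_≡_; _≢_)
open import Function.Definitions using (Injective)

record Graph : Set where
  field
    n      : ℕ
    adj    : Fin n → Fin n → Bool
    sym    : ∀ u v → adj u v ≡ adj v u
    irrefl : ∀ v → adj v v ≡ false

pathAdj : (k : ℕ) → Fin k → Fin k → Bool
pathAdj k a b = (suc (toℕ a) ≡ᵇ toℕ b) ∨ (suc (toℕ b) ≡ᵇ toℕ a)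

cycleAdj : (k : ℕ) → Fin k → Fin k → Bool
cycleAdj k a b = pathAdj k a b
               ∨ ((toℕ a ≡ᵇ 0) ∧ (suc (toℕ b) ≡ᵇ k))
               ∨ ((toℕ b ≡ᵇ 0) ∧ (suc (toℕ a) ≡ᵇ k))

complAdj : {k : ℕ} → (Fin k → Fin k → Bool) → Fin k → Fin k → Bool
complAdj h a b = not (h a b) ∧ not (toℕ a ≡ᵇ toℕ b)

module _ (G : Graph) where
  open Graph G

  V : Set
  V = Fin n

  VSet : Set₁
  VSet = V → Set

  ContainsInduced : {k : ℕ} → (Fin k → Fin k → Bool) → Set
  ContainsInduced {k} h =
    Σ (Fin k → V) λ f → Injective _≡_ _≡_ f × (∀ a b → adj (f a) (f b) ≡ h a b)

  E : V → V → Set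
  E u v = adj u v ≡ true

  NE : V → V → Set
  NE u v = adj u v ≡ false

  CompleteTo : V → VSet → Set
  CompleteTo v S = ∀ u → S u → E v u

  AnticompleteTo : V → VSet → Set
  AnticompleteTo v S = ∀ u → S u → NE v u

  MixedOn : V → VSet → Set
  MixedOn v S = (∃[ u ] (S u × E v u)) × (∃[ w ] (S w × NE v w))

  SetComplete : VSet → VSet → Set
  SetComplete S T = ∀ v → S v → CompleteTo v T

  SetAnticomplete : VSet → VSet → Set
  SetAnticomplete S T = ∀ v → S v → AnticompleteTo v T

  NonEmpty : VSet → Set
  NonEmpty S = ∃[ v ] S v

  Big : VSet → Set
  Big S = ∃[ u ] ∃[ w ] (u ≢ w × S u × S w)

  Stable : VSet → Set
  Stable S = ∀ u v → S u → S v → NE u v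

  Clique : VSet → Set
  Clique S = ∀ u v → S u → S v → u ≢ v → E u v

  data Reach (R : V → V → Set) (S : VSet) (u : V) : V → Set where
    here : S u → Reach R S u u
    step : ∀ {w v} → Reach R S u w → R w v → S v → Reach R S u v

  Connected : VSet → Set
  Connected S = NonEmpty S × (∀ u v → S u → S v → Reach E S u v)

  CE : V → V → Set
  CE u v = u ≢ v × NE u v

  AntiConnected : VSet → Set
  AntiConnected S = NonEmpty S × (∀ u v → S u → S v → Reach CE S u v)

  -- Z is an anticomponent of S: Z is a connected component of the
  -- complement of G[S] (non-empty, contained in S, anticonnected, and no
  -- complement edge from Z to S \ Z)
  Anticomponent : VSet → VSet → Set
  Anticomponent S Z =
    (∀ v → Z v → S v) × AntiConnected Z
    × (∀ z w → Z z → S w → ¬ Z w → E z w)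

  Homogeneous : VSet → Set
  Homogeneous S = NonEmpty S × (∀ v → ¬ S v → CompleteTo v S ⊎ AnticompleteTo v S)

  ProperSet : VSet → Set
  ProperSet S = Big S × (∃[ v ] ¬ S v)

  Prime : Set
  Prime = (S : Subset n) → Homogeneous (_∈ S) → ¬ ProperSet (_∈ S)

  -- The structure of Theorem 2.3, for index sets X_0..X_m, Y_0..Y_m
  -- (index F.zero is the index 0; F.suc i for i : Fin m ranges over 1..m)

  record Structure (m : ℕ) (X Y : Fin (suc m) → Subset n) : Set where
    X0 : VSet
    X0 v = v ∈ X F.zero
    Xi : Fin m → VSet
    Xi i v = v ∈ X (F.suc i)
    Yi : Fin m → VSet
    Yi i v = v ∈ Y (F.suc i)
    XS : VSet
    XS v = ∃[ i ] (v ∈ X i)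
    YS : VSet
    YS v = ∃[ i ] (v ∈ Y i)
    XZ : Subset n → VSet
    XZ Z v = X0 v × MixedOn v (_∈ Z)
    BigAC : VSet → Subset n → Set
    BigAC S Z = Anticomponent S (_∈ Z) × Big (_∈ Z)
    field
      disjX  : ∀ i j → i ≢ j → ∀ v → v ∈ X i → v ∉ X j
      disjY  : ∀ i j → i ≢ j → ∀ v → v ∈ Y i → v ∉ Y j
      disjXY : ∀ i j → ∀ v → v ∈ X i → v ∉ Y j
      cover  : ∀ v → XS v ⊎ YS v
      c1-conn   : ∀ i → Connected (Xi i)
      c1-big    : ∀ i → Big (Xi i)
      c1-stable : Stable X0
      c1-anti   : ∀ i j → i ≢ j → SetAnticomplete (_∈ X i) (_∈ X j)
      c2-ne    : ∀ i → NonEmpty (Yi i)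
      c2-mixed : ∀ i y → Yi i y → MixedOn y (Xi i)
      c2-comp  : ∀ i y → Yi i y → CompleteTo y (λ v → XS v × ¬ Xi i v × ¬ X0 v)
      c2-Y0    : ∀ y → y ∈ Y F.zero → CompleteTo y (λ v → XS v × ¬ X0 v)
      c3 : ∀ i j → i ≢ j → SetComplete (_∈ Y i) (_∈ Y j)
      c4 : ∀ v → XS v → ¬ X0 v → (Z : Subset n) → Anticomponent YS (_∈ Z)
           → ¬ MixedOn v (_∈ Z)
      c5 : ∀ i → ∃[ v ] (Xi i v × CompleteTo v YS)
      c6 : ∀ v → X0 v → (Z Z' : Subset n)
           → Anticomponent YS (_∈ Z) → Anticomponent YS (_∈ Z')
           → MixedOn v (_∈ Z) → MixedOn v (_∈ Z') → Z ≡ Z'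
      c7-ne   : (Z : Subset n) → BigAC YS Z → NonEmpty (XZ Z)
      c7-disj : (Z Z' : Subset n) → BigAC YS Z → BigAC YS Z' → Z ≢ Z'
                → ∀ v → XZ Z v → ¬ XZ Z' v
      c8 : (Z : Subset n) → BigAC YS Z → ∃[ z ] (z ∈ Z × AnticompleteTo z (XZ Z))
      c9 : ¬ Clique YS → ∃[ Z ] (BigAC YS Z
             × ((Z' : Subset n) → BigAC (λ v → YS v × v ∉ Z) Z'
                → SetAnticomplete (XZ Z) (_∈ Z')))

{-# OPTIONS --safe #-}

-- Take X maximal such that G[X] has at least two big components, K 0, …, K (m - 1).  By maximality
-- every y outside X has a neighbour in each K i, and P₅-freeness makes it mixed on at most one of
-- them, which sorts Y = V ∖ X into Y₀, …, Yₘ; primality makes Y₁, …, Yₘ non-empty and makes some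
-- vertex of X₀ mixed on every big anticomponent of Y.  The vertices asked for in (5) and (8) have
-- inclusion-maximal neighbourhood in Y, respectively non-neighbourhood in X_Z.  For (9), if
-- x ∈ X_Z is complete to Z' and some x' ∈ X_Z' is adjacent to w ∉ Z', then x is adjacent to w,
-- since otherwise there is a house; so domination between big anticomponents is a strict partial
-- order, and a terminal one exists.
module Submission where

open import Defs
open import Data.Nat using (ℕ; suc; _≤_; z≤n; s≤s)
open import Data.Bool using (Bool; true; false) renaming (_≟_ to _≟ᵇ_)
open import Data.Empty using (⊥; ⊥-elim)
open import Data.Fin using (Fin; zero; suc) renaming (_≟_ to _≟ᶠ_)
open import Data.Fin.Patterns using (0F; 1F; 2F; 3F; 4F)
open import Data.Fin.Properties using (any?; all?)
open import Data.Fin.Subset using (Subset; _∈_; _∉_; _⊆_; _⊂_; _⊃_; _∪_; ⁅_⁆) renaming (⊥ to ∅)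
open import Data.Fin.Subset.Induction using (⊃-wellFounded; Acc; acc)
open import Data.Fin.Subset.Properties
  using (_∈?_; ⊆-antisym; x∈⁅x⁆; x∈⁅y⁆⇒x≡y; p⊆p∪q; q⊆p∪q; x∈p∪q⁻)
open import Data.List using (List; map; filter; allFin; deduplicate; length; lookup)
import Data.List.Membership.Propositional as L
open import Data.List.Membership.Propositional.Properties
  using (∈-map∘filter⁺; ∈-map∘filter⁻; ∈-deduplicate⁺; ∈-deduplicate⁻; ∈-lookup; ∈-allFin)
open import Data.List.Relation.Unary.All as All using ()
open import Data.List.Relation.Unary.AllPairs using (_∷_)
open import Data.List.Relation.Unary.Any using (index)
open import Data.List.Relation.Unary.Any.Properties using (lookup-index)
open import Data.List.Relation.Unary.Unique.Propositional using (Unique)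
import Data.List.Relation.Unary.Unique.DecPropositional.Properties as UniqueDec
open import Data.Product using (Σ; ∃; ∃-syntax; _×_; _,_; proj₁; proj₂)
open import Data.Sum using (_⊎_; inj₁; inj₂)
open import Data.Vec using (tabulate)
open import Data.Vec.Properties using (lookup∘tabulate; lookup⇒[]=; []=⇒lookup; ≡-dec)
open import Relation.Nullary using (¬_; Dec; yes; no; does; contradiction)
open import Relation.Nullary.Decidable using (dec-true; from-yes; ¬?; _×-dec_; _→-dec_)
open import Relation.Binary.Definitions using (Symmetric)
open import Relation.Binary.PropositionalEquality using (_≡_; _≢_; refl; sym; trans; cong; subst)
open import Function using (_∘_)

-- Finite subsets, growth arguments and repetition-free lists.

does-true : {A : Set} (d : Dec A) → does d ≡ true → A
does-true (yes a) _ = a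

module _ {n : ℕ} where

  comprehension : {P : Fin n → Set} → (∀ v → Dec (P v)) → Subset n
  comprehension P? = tabulate (does ∘ P?)

  module _ {P : Fin n → Set} (P? : ∀ v → Dec (P v)) where

    ∈-comprehension⁺ : ∀ {v} → P v → v ∈ comprehension P?
    ∈-comprehension⁺ {v} p = lookup⇒[]= v _ (trans (lookup∘tabulate _ v) (dec-true (P? v) p))

    ∈-comprehension⁻ : ∀ {v} → v ∈ comprehension P? → P v
    ∈-comprehension⁻ {v} v∈ = does-true (P? v) (trans (sym (lookup∘tabulate _ v)) ([]=⇒lookup v∈))

  -- Maximality arguments: an element with maximal N must reach the goal, as subsets cannot grow forever.
  climb : {A Goal : Set} (N : A → Subset n) → (∀ a → Goal ⊎ ∃[ b ] N a ⊂ N b) → A → Goal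
  climb {A} {Goal} N next a = go a (⊃-wellFounded (N a))
    where
    go : ∀ a → Acc _⊃_ (N a) → Goal
    go a (acc rec) with next a
    ... | inj₁ goal     = goal
    ... | inj₂ (b , a⊂b) = go b (rec a⊂b)

lookup-injective : {A : Set} {xs : List A} → Unique xs → ∀ i j → lookup xs i ≡ lookup xs j → i ≡ j
lookup-injective (_ ∷ _)  zero    zero    _  = refl
lookup-injective (x∉ ∷ _) zero    (suc j) eq = contradiction eq (All.lookup x∉ (∈-lookup j))
lookup-injective (x∉ ∷ _) (suc i) zero    eq = contradiction (sym eq) (All.lookup x∉ (∈-lookup i))
lookup-injective (_ ∷ u)  (suc i) (suc j) eq = cong suc (lookup-injective u i j eq)

distinct⇒2≤ : ∀ {m} {i j : Fin m} → i ≢ j → 2 ≤ m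
distinct⇒2≤ {1}           {zero} {zero} i≢j = contradiction refl i≢j
distinct⇒2≤ {suc (suc _)}               _   = s≤s (s≤s z≤n)

another : ∀ {m} → 2 ≤ m → (i : Fin m) → ∃[ j ] i ≢ j
another (s≤s (s≤s _)) zero    = suc zero , λ ()
another (s≤s (s≤s _)) (suc _) = zero , λ ()

-- Adjacency, non-adjacency and mixedness.

module _ (G : Graph) where

  open Graph G renaming (sym to adj-sym)

  infix 4 _~_ _≁_ _~?_ _≁?_

  _~_ _≁_ : Fin n → Fin n → Set
  _~_ = E G
  _≁_ = NE G

  _~?_ : ∀ u v → Dec (u ~ v)
  u ~? v = adj u v ≟ᵇ true

  _≁?_ : ∀ u v → Dec (u ≁ v)
  u ≁? v = adj u v ≟ᵇ false

  CE? : ∀ u v → Dec (CE G u v)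
  CE? u v = ¬? (u ≟ᶠ v) ×-dec (u ≁? v)

  ~-sym : Symmetric _~_
  ~-sym {u} {v} uv = trans (adj-sym v u) uv

  ≁-sym : Symmetric _≁_
  ≁-sym {u} {v} uv = trans (adj-sym v u) uv

  CE-sym : Symmetric (CE G)
  CE-sym (u≢v , uv) = u≢v ∘ sym , ≁-sym uv

  ~⇒¬≁ : ∀ {u v} → u ~ v → ¬ u ≁ v
  ~⇒¬≁ uv nuv with () ← trans (sym uv) nuv

  ¬~⇒≁ : ∀ {u v} → ¬ u ~ v → u ≁ v
  ¬~⇒≁ {u} {v} ¬uv with adj u v
  ... | true  = contradiction refl ¬uv
  ... | false = refl

  ¬≁⇒~ : ∀ {u v} → ¬ u ≁ v → u ~ v
  ¬≁⇒~ {u} {v} ¬uv with adj u v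
  ... | true  = refl
  ... | false = contradiction refl ¬uv

  ~⇒≢ : ∀ {u v} → u ~ v → u ≢ v
  ~⇒≢ {u} uv refl = ~⇒¬≁ uv (irrefl u)

  separated⇒≢ : ∀ {x u v} → x ~ u → x ≁ v → u ≢ v
  separated⇒≢ xu xv refl = ~⇒¬≁ xu xv

  ≢-¬CE⇒~ : ∀ {u v} → u ≢ v → ¬ CE G u v → u ~ v
  ≢-¬CE⇒~ u≢v ¬uv = ¬≁⇒~ λ uv → ¬uv (u≢v , uv)

  MixedOn? : ∀ v (Z : Subset n) → Dec (MixedOn G v (_∈ Z))
  MixedOn? v Z = any? (λ u → (u ∈? Z) ×-dec (v ~? u)) ×-dec any? (λ w → (w ∈? Z) ×-dec (v ≁? w))

  complete-or-anticomplete : ∀ v (Z : Subset n) → ¬ MixedOn G v (_∈ Z) →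
    CompleteTo G v (_∈ Z) ⊎ AnticompleteTo G v (_∈ Z)
  complete-or-anticomplete v Z ¬mixed with any? (λ u → (u ∈? Z) ×-dec (v ~? u))
  ... | yes nbr = inj₁ λ u u∈Z → ¬≁⇒~ λ vu → ¬mixed (nbr , u , u∈Z , vu)
  ... | no ∄nbr = inj₂ λ u u∈Z → ¬~⇒≁ λ vu → ∄nbr (u , u∈Z , vu)

  -- Walks in a set with respect to an arbitrary relation.

  module _ {R : Fin n → Fin n → Set} {S : Fin n → Set} where

    reach-target : ∀ {u v} → Reach G R S u v → S v
    reach-target (here s)     = s
    reach-target (step _ _ s) = s

    reach-trans : ∀ {u v w} → Reach G R S u v → Reach G R S v w → Reach G R S u w
    reach-trans p (here _)     = p
    reach-trans p (step q e s) = step (reach-trans p q) e s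

    reach-sym : Symmetric R → ∀ {u v} → Reach G R S u v → Reach G R S v u
    reach-sym R-sym (here s)     = here s
    reach-sym R-sym (step r e s) =
      reach-trans (step (here s) (R-sym e) (reach-target r)) (reach-sym R-sym r)

    reach-mono : {T : Fin n → Set} → (∀ {v} → S v → T v) → ∀ {u v} → Reach G R S u v → Reach G R T u v
    reach-mono S⊆T (here s)     = here (S⊆T s)
    reach-mono S⊆T (step r e s) = step (reach-mono S⊆T r) e (S⊆T s)

    module _ {Q : Fin n → Set} (Q? : ∀ v → Dec (Q v)) where

      -- With `Q` adjacency (or non-adjacency) to a fixed vertex, this is how a vertex that is mixed
      -- on a connected or anticonnected set yields the consecutive pair from which forbidden
      -- subgraphs are built.
      crossing : ∀ {u v} → Reach G R S u v → Q u → ¬ Q v →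
        ∃[ a ] ∃[ b ] (S a × S b × R a b × Q a × ¬ Q b)
      crossing (here _) q ¬q = contradiction q ¬q
      crossing (step {w} {v} r e s) q ¬q with Q? w
      ... | yes qw = w , v , reach-target r , s , e , qw , ¬q
      ... | no ¬qw = crossing r q ¬qw

      -- If no induced path w p q of R leaves Q at its first vertex, then the vertices of Q dominate S.
      dominated : (∀ u v → Dec (R u v)) →
        (∀ {w p q} → S w → S p → S q → R w p → R p q → ¬ R w q → Q w → ¬ Q p → ¬ Q q → ⊥) →
        ∀ {u v} → Reach G R S u v → Q u → ¬ Q v → ∃[ w ] (S w × R w v × Q w)
      dominated R? bad (here _) q ¬q = contradiction q ¬q
      dominated R? bad (step {p} {v} r e s) q ¬q with Q? p
      ... | yes qp = p , reach-target r , e , qp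
      ... | no ¬qp with dominated R? bad r q ¬qp
      ...   | w , sw , wp , qw with R? w v
      ...     | yes wv = w , sw , wv , qw
      ...     | no ¬wv = ⊥-elim (bad sw (reach-target r) s wp e ¬wv qw ¬qp ¬q)

  -- At least one of the two distinct members differs from `v`, and a walk from `v` to it has to
  -- leave the singleton of `v`.
  big-connected⇒neighbour : ∀ {R : Fin n → Fin n → Set} {S : Fin n → Set} → Big G S →
    (∀ u v → S u → S v → Reach G R S u v) → ∀ {v} → S v → ∃[ w ] (S w × R v w)
  big-connected⇒neighbour {R} {S} (a , b , a≢b , Sa , Sb) reach {v} Sv with a ≟ᶠ v
  ... | yes refl = leave (reach v b Sv Sb) (a≢b ∘ sym)
    where
    leave : ∀ {t} → Reach G R S v t → t ≢ v → ∃[ w ] (S w × R v w)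
    leave r t≢v with crossing (_≟ᶠ v) r refl t≢v
    ... | _ , w , _ , Sw , vw , refl , _ = w , Sw , vw
  ... | no a≢v with crossing (_≟ᶠ v) (reach v a Sv Sa) refl a≢v
  ...   | _ , w , _ , Sw , vw , refl , _ = w , Sw , vw

  -- Components of a relation, covering both components and anticomponents.

  IsComponent : (R : Fin n → Fin n → Set) (S : Fin n → Set) → Subset n → Set
  IsComponent R S Z =
    (∀ v → v ∈ Z → S v)
    × (NonEmpty G (_∈ Z) × (∀ u v → u ∈ Z → v ∈ Z → Reach G R (_∈ Z) u v))
    × (∀ z w → z ∈ Z → S w → w ∉ Z → ¬ R z w)

  module _ {R : Fin n → Fin n → Set} {S : Fin n → Set} where

    component-⊆ : ∀ {Z Z′ z} → IsComponent R S Z → IsComponent R S Z′ → z ∈ Z → z ∈ Z′ → Z ⊆ Z′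
    component-⊆ {Z} {Z′} {z} (Z⊆S , (_ , reach) , _) (_ , _ , closed) z∈Z z∈Z′ {v} v∈Z with v ∈? Z′
    ... | yes v∈Z′ = v∈Z′
    ... | no v∉Z′ with crossing (_∈? Z′) (reach z v z∈Z v∈Z) z∈Z′ v∉Z′
    ...   | a , b , _ , b∈Z , ab , a∈Z′ , b∉Z′ = ⊥-elim (closed a b a∈Z′ (Z⊆S b b∈Z) b∉Z′ ab)

    component-unique : ∀ {Z Z′ z} → IsComponent R S Z → IsComponent R S Z′ → z ∈ Z → z ∈ Z′ → Z ≡ Z′
    component-unique c c′ z∈Z z∈Z′ =
      ⊆-antisym (component-⊆ c c′ z∈Z z∈Z′) (component-⊆ c′ c z∈Z′ z∈Z)

    -- Grow the singleton of `u` one vertex at a time, keeping every member reachable from `u`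
    -- inside the set itself. When no `R`-edge leads to a further vertex of `S`, the set is a
    -- component.
    component : Symmetric R → (∀ u v → Dec (R u v)) → (∀ v → Dec (S v)) → ∀ u → S u →
      ∃[ Z ] (u ∈ Z × IsComponent R S Z)
    component R-sym R? S? u Su = climb proj₁ next (⁅ u ⁆ , start)
      where
      Grown : Subset n → Set
      Grown Z = u ∈ Z × (∀ v → v ∈ Z → S v) × (∀ v → v ∈ Z → Reach G R (_∈ Z) u v)

      start : Grown ⁅ u ⁆
      start = x∈⁅x⁆ u
            , (λ v v∈ → subst S (sym (x∈⁅y⁆⇒x≡y u v∈)) Su)
            , (λ v v∈ → subst (Reach G R (_∈ ⁅ u ⁆) u) (sym (x∈⁅y⁆⇒x≡y u v∈)) (here (x∈⁅x⁆ u)))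

      next : (a : ∃ Grown) → (∃[ Z ] (u ∈ Z × IsComponent R S Z)) ⊎ (∃[ b ] proj₁ a ⊂ proj₁ b)
      next (Z , u∈Z , Z⊆S , reach)
        with any? (λ z → any? (λ w → (z ∈? Z) ×-dec S? w ×-dec ¬? (w ∈? Z) ×-dec R? z w))
      ... | no stuck = inj₁ (Z , u∈Z , Z⊆S
            , ((u , u∈Z) , λ v w v∈ w∈ → reach-trans (reach-sym R-sym (reach v v∈)) (reach w w∈))
            , λ z w z∈ Sw w∉ zw → stuck (z , w , z∈ , Sw , w∉ , zw))
      ... | yes (z , w , z∈Z , Sw , w∉Z , zw) =
            inj₂ ((Z ∪ ⁅ w ⁆ , old u∈Z , within , reach′) , old , w , new , w∉Z)
        where
        old : Z ⊆ Z ∪ ⁅ w ⁆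
        old = p⊆p∪q ⁅ w ⁆
        new : w ∈ Z ∪ ⁅ w ⁆
        new = q⊆p∪q Z ⁅ w ⁆ (x∈⁅x⁆ w)
        within : ∀ v → v ∈ Z ∪ ⁅ w ⁆ → S v
        within v v∈ with x∈p∪q⁻ Z ⁅ w ⁆ v∈
        ... | inj₁ v∈Z = Z⊆S v v∈Z
        ... | inj₂ v∈w = subst S (sym (x∈⁅y⁆⇒x≡y w v∈w)) Sw
        reach′ : ∀ v → v ∈ Z ∪ ⁅ w ⁆ → Reach G R (_∈ (Z ∪ ⁅ w ⁆)) u v
        reach′ v v∈ with x∈p∪q⁻ Z ⁅ w ⁆ v∈
        ... | inj₁ v∈Z = reach-mono old (reach v v∈Z)
        ... | inj₂ v∈w rewrite x∈⁅y⁆⇒x≡y w v∈w = step (reach-mono old (reach z z∈Z)) zw new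

  anticomponent⇒component : ∀ {S Z} → Anticomponent G S (_∈ Z) → IsComponent (CE G) S Z
  anticomponent⇒component (Z⊆S , conn , closed) =
    Z⊆S , conn , λ z w z∈ Sw w∉ zw → ~⇒¬≁ (closed z w z∈ Sw w∉) (proj₂ zw)

  component⇒anticomponent : ∀ {S Z} → IsComponent (CE G) S Z → Anticomponent G S (_∈ Z)
  component⇒anticomponent (Z⊆S , conn , closed) =
    Z⊆S , conn , λ z w z∈ Sw w∉ → ≢-¬CE⇒~ (λ { refl → w∉ z∈ }) (closed z w z∈ Sw w∉)

  -- The forbidden induced subgraphs on five vertices.

  -- h is twin-free, so the embedding need not be assumed injective.
  induced : (h : Fin 5 → Fin 5 → Bool) →
    (∀ a b → h a b ≡ h b a) → (∀ a → h a a ≡ false) →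
    (∀ a b → (∀ c → h a c ≡ h b c) → a ≡ b) →
    ∀ {v₀ v₁ v₂ v₃ v₄} →
    adj v₀ v₁ ≡ h 0F 1F → adj v₀ v₂ ≡ h 0F 2F → adj v₀ v₃ ≡ h 0F 3F → adj v₀ v₄ ≡ h 0F 4F →
    adj v₁ v₂ ≡ h 1F 2F → adj v₁ v₃ ≡ h 1F 3F → adj v₁ v₄ ≡ h 1F 4F →
    adj v₂ v₃ ≡ h 2F 3F → adj v₂ v₄ ≡ h 2F 4F → adj v₃ v₄ ≡ h 3F 4F →
    ContainsInduced G h
  induced h h-sym h-irr h-red {v₀} {v₁} {v₂} {v₃} {v₄} e₀₁ e₀₂ e₀₃ e₀₄ e₁₂ e₁₃ e₁₄ e₂₃ e₂₄ e₃₄ =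
    f , (λ {a} {b} fa≡fb → h-red a b λ c →
           trans (sym (agree a c)) (trans (cong (λ v → adj v (f c)) fa≡fb) (agree b c)))
      , agree
    where
    f : Fin 5 → Fin n
    f 0F = v₀
    f 1F = v₁
    f 2F = v₂
    f 3F = v₃
    f 4F = v₄

    loop : ∀ a → adj (f a) (f a) ≡ h a a
    loop a = trans (irrefl (f a)) (sym (h-irr a))

    mirror : ∀ a b → adj (f a) (f b) ≡ h a b → adj (f b) (f a) ≡ h b a
    mirror a b e = trans (adj-sym (f b) (f a)) (trans e (h-sym a b))

    agree : ∀ a b → adj (f a) (f b) ≡ h a b
    agree 0F 0F = loop 0F
    agree 0F 1F = e₀₁
    agree 0F 2F = e₀₂
    agree 0F 3F = e₀₃
    agree 0F 4F = e₀₄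
    agree 1F 0F = mirror 0F 1F e₀₁
    agree 1F 1F = loop 1F
    agree 1F 2F = e₁₂
    agree 1F 3F = e₁₃
    agree 1F 4F = e₁₄
    agree 2F 0F = mirror 0F 2F e₀₂
    agree 2F 1F = mirror 1F 2F e₁₂
    agree 2F 2F = loop 2F
    agree 2F 3F = e₂₃
    agree 2F 4F = e₂₄
    agree 3F 0F = mirror 0F 3F e₀₃
    agree 3F 1F = mirror 1F 3F e₁₃
    agree 3F 2F = mirror 2F 3F e₂₃
    agree 3F 3F = loop 3F
    agree 3F 4F = e₃₄
    agree 4F 0F = mirror 0F 4F e₀₄
    agree 4F 1F = mirror 1F 4F e₁₄
    agree 4F 2F = mirror 2F 4F e₂₄
    agree 4F 3F = mirror 3F 4F e₃₄
    agree 4F 4F = loop 4F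

  symmetric? : (h : Fin 5 → Fin 5 → Bool) → Dec (∀ a b → h a b ≡ h b a)
  symmetric? h = all? λ a → all? λ b → h a b ≟ᵇ h b a

  irreflexive? : (h : Fin 5 → Fin 5 → Bool) → Dec (∀ a → h a a ≡ false)
  irreflexive? h = all? λ a → h a a ≟ᵇ false

  twin-free? : (h : Fin 5 → Fin 5 → Bool) → Dec (∀ a b → (∀ c → h a c ≡ h b c) → a ≡ b)
  twin-free? h = all? λ a → all? λ b → all? (λ c → h a c ≟ᵇ h b c) →-dec (a ≟ᶠ b)

  -- The house is listed along the path a b c d e of its complement.
  P₅-free House-free C₅-free : Set
  P₅-free = ∀ {a b c d e} →
    a ~ b → a ≁ c → a ≁ d → a ≁ e → b ~ c → b ≁ d → b ≁ e → c ~ d → c ≁ e → d ~ e → ⊥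
  House-free = ∀ {a b c d e} →
    a ≁ b → a ~ c → a ~ d → a ~ e → b ≁ c → b ~ d → b ~ e → c ≁ d → c ~ e → d ≁ e → ⊥
  C₅-free = ∀ {a b c d e} →
    a ~ b → a ≁ c → a ≁ d → a ~ e → b ~ c → b ≁ d → b ≁ e → c ~ d → c ≁ e → d ~ e → ⊥

  p₅-free : ¬ ContainsInduced G (pathAdj 5) → P₅-free
  p₅-free free ab ac ad ae bc bd be cd ce de = free
    -- The side conditions on the pattern range over five vertices, so evaluating their decision
    -- procedures proves them.
    (induced (pathAdj 5) (from-yes (symmetric? (pathAdj 5))) (from-yes (irreflexive? (pathAdj 5)))
      (from-yes (twin-free? (pathAdj 5))) ab ac ad ae bc bd be cd ce de)

  house-free : ¬ ContainsInduced G (complAdj (pathAdj 5)) → House-free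
  house-free free ab ac ad ae bc bd be cd ce de = free
    (induced h (from-yes (symmetric? h)) (from-yes (irreflexive? h))
      (from-yes (twin-free? h)) ab ac ad ae bc bd be cd ce de)
    where
    h : Fin 5 → Fin 5 → Bool
    h = complAdj (pathAdj 5)

  c₅-free : ¬ ContainsInduced G (cycleAdj 5) → C₅-free
  c₅-free free ab ac ad ae bc bd be cd ce de = free
    (induced (cycleAdj 5) (from-yes (symmetric? (cycleAdj 5))) (from-yes (irreflexive? (cycleAdj 5)))
      (from-yes (twin-free? (cycleAdj 5))) ab ac ad ae bc bd be cd ce de)

  -- The big components of an induced subgraph.

  record BigComponents (X : Subset n) : Set where
    field
      m           : ℕ
      K           : Fin m → Subset n
      isComponent : ∀ i → IsComponent _~_ (_∈ X) (K i)
      big         : ∀ i → Big G (_∈ K i)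
      K-injective : ∀ i j → K i ≡ K j → i ≡ j
      -- One-vertex components are not listed; their vertices are the isolated ones, which later
      -- form X₀.
      cover       : ∀ v → v ∈ X → (∀ w → w ∈ X → v ≁ w) ⊎ ∃[ i ] v ∈ K i

    K⊆X : ∀ {i v} → v ∈ K i → v ∈ X
    K⊆X {i} {v} = proj₁ (isComponent i) v

    K-connected : ∀ {i u v} → u ∈ K i → v ∈ K i → Reach G _~_ (_∈ K i) u v
    K-connected {i} {u} {v} = proj₂ (proj₁ (proj₂ (isComponent i))) u v

    K-disjoint : ∀ {i j v} → v ∈ K i → v ∈ K j → i ≡ j
    K-disjoint {i} {j} v∈i v∈j =
      K-injective i j (component-unique (isComponent i) (isComponent j) v∈i v∈j)

    K-closed : ∀ {i u v} → u ∈ K i → v ∈ X → v ∉ K i → u ≁ v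
    K-closed {i} {u} {v} u∈ v∈X v∉ = ¬~⇒≁ (proj₂ (proj₂ (isComponent i)) u v u∈ v∈X v∉)

    K-anticomplete : ∀ {i j u v} → i ≢ j → u ∈ K i → v ∈ K j → u ≁ v
    K-anticomplete i≢j u∈ v∈ = K-closed u∈ (K⊆X v∈) λ v∈i → i≢j (K-disjoint v∈i v∈)

    K-neighbour : ∀ {i v} → v ∈ K i → ∃[ w ] (w ∈ K i × v ~ w)
    K-neighbour {i} = big-connected⇒neighbour (big i) λ _ _ → K-connected

    K-edge : ∀ i → ∃[ a ] ∃[ b ] (a ∈ K i × b ∈ K i × a ~ b)
    K-edge i with big i
    ... | a , _ , _ , a∈ , _ with K-neighbour a∈
    ...   | b , b∈ , ab = a , b , a∈ , b∈ , ab

    edge∈K : ∀ {a b} → a ∈ X → b ∈ X → a ~ b → ∃[ i ] a ∈ K i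
    edge∈K {a} {b} a∈ b∈ ab with cover a a∈
    ... | inj₁ isolated = ⊥-elim (~⇒¬≁ ab (isolated b b∈))
    ... | inj₂ a∈K      = a∈K

    -- Each edge puts its first end in a big component. If the two components coincided, a walk
    -- inside it from `a` to `c` would leave `S` along an edge, against `closed`.
    separated⇒2≤m : {S : Fin n → Set} → (∀ v → Dec (S v)) →
      (∀ {s t} → s ∈ X → t ∈ X → S s → ¬ S t → s ≁ t) →
      ∀ {a b c d} → a ∈ X → b ∈ X → c ∈ X → d ∈ X → a ~ b → c ~ d → S a → ¬ S c → 2 ≤ m
    separated⇒2≤m {S} S? closed {a} {b} {c} {d} a∈ b∈ c∈ d∈ ab cd Sa ¬Sc
      with edge∈K a∈ b∈ ab | edge∈K c∈ d∈ cd
    ... | i , a∈i | j , c∈j = distinct⇒2≤ {i = i} {j} i≢j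
      where
      i≢j : i ≢ j
      i≢j refl with crossing S? (K-connected a∈i c∈j) Sa ¬Sc
      ... | s , t , s∈ , t∈ , st , Ss , ¬St = ~⇒¬≁ st (closed (K⊆X s∈) (K⊆X t∈) Ss ¬St)

  -- Every vertex with a neighbour in `X` contributes its component, which is big because it
  -- contains that neighbour. Removing repetitions makes distinct indices stand for distinct
  -- components.
  bigComponents : (X : Subset n) → BigComponents X
  bigComponents X = record
    { m           = length components
    ; K           = lookup components
    ; isComponent = λ i → proj₁ (genuine (∈-lookup i))
    ; big         = λ i → proj₂ (genuine (∈-lookup i))
    ; K-injective = lookup-injective (UniqueDec.deduplicate-! _≟ˢ_ (map componentOf (filter linked? (allFin n))))
    ; cover       = cover
    }
    where
    _≟ˢ_ : (p q : Subset n) → Dec (p ≡ q)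
    _≟ˢ_ = ≡-dec _≟ᵇ_

    componentOf : Fin n → Subset n
    componentOf v with v ∈? X
    ... | yes v∈X = proj₁ (component ~-sym _~?_ (_∈? X) v v∈X)
    -- A dummy value: only vertices that pass `linked?`, hence lie in `X`, contribute to
    -- `components`.
    ... | no _    = ∅

    componentOf-correct : ∀ v → v ∈ X → v ∈ componentOf v × IsComponent _~_ (_∈ X) (componentOf v)
    componentOf-correct v v∈X with v ∈? X
    ... | yes p = proj₂ (component ~-sym _~?_ (_∈? X) v p)
    ... | no v∉ = contradiction v∈X v∉

    Linked : Fin n → Set
    Linked v = v ∈ X × ∃[ w ] (w ∈ X × v ~ w)

    linked? : ∀ v → Dec (Linked v)
    linked? v = (v ∈? X) ×-dec any? (λ w → (w ∈? X) ×-dec (v ~? w))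

    components : List (Subset n)
    components = deduplicate _≟ˢ_ (map componentOf (filter linked? (allFin n)))

    genuine : ∀ {Z} → Z L.∈ components → IsComponent _~_ (_∈ X) Z × Big G (_∈ Z)
    genuine Z∈ with ∈-map∘filter⁻ componentOf linked? {xs = allFin n} (∈-deduplicate⁻ _≟ˢ_ _ Z∈)
    ... | v , _ , refl , v∈X , w , w∈X , vw with componentOf-correct v v∈X
    ...   | v∈Z , isC with w ∈? componentOf v
    ...     | yes w∈Z = isC , v , w , ~⇒≢ vw , v∈Z , w∈Z
    ...     | no w∉Z  = ⊥-elim (proj₂ (proj₂ isC) v w v∈Z w∈X w∉Z vw)

    cover : ∀ v → v ∈ X → (∀ w → w ∈ X → v ≁ w) ⊎ ∃[ i ] v ∈ lookup components i
    cover v v∈X with any? (λ w → (w ∈? X) ×-dec (v ~? w))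
    ... | no isolated = inj₁ λ w w∈X → ¬~⇒≁ λ vw → isolated (w , w∈X , vw)
    ... | yes nbr = inj₂ (index listed , subst (v ∈_) (lookup-index listed) (proj₁ (componentOf-correct v v∈X)))
      where
      listed : componentOf v L.∈ components
      listed = ∈-deduplicate⁺ _≟ˢ_ (∈-map∘filter⁺ componentOf linked? (v , ∈-allFin v , refl , v∈X , nbr))

  -- A set with two big components to which every outside vertex attaches.

  Skeleton : Set
  Skeleton = ∃[ X ] Σ (BigComponents X) λ F → let open BigComponents F in
    2 ≤ m × (∀ {y} → y ∉ X → ∀ i → ∃[ a ] (a ∈ K i × y ~ a))

  skeleton : ContainsInduced G (complAdj (cycleAdj 4)) → Skeleton
  skeleton (f , _ , agree) = climb proj₁ next (X₀ , bigComponents X₀ , start)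
    where
    in-image? : ∀ v → Dec (∃[ a ] v ≡ f a)
    in-image? v = any? λ a → v ≟ᶠ f a

    X₀ : Subset n
    X₀ = comprehension in-image?

    f∈X₀ : ∀ a → f a ∈ X₀
    f∈X₀ a = ∈-comprehension⁺ in-image? (a , refl)

    -- These are `f 0F` and `f 2F`, the ends of one of the two edges of the complement of C₄.
    -- Describing them by non-adjacency to 1 and 3 lets `sides-anticomplete` and `¬side₁` be read
    -- off from `agree`.
    Side : Fin n → Set
    Side v = ∃[ a ] (v ≡ f a × complAdj (cycleAdj 4) a 1F ≡ false × complAdj (cycleAdj 4) a 3F ≡ false)

    side? : ∀ v → Dec (Side v)
    side? v = any? λ a → (v ≟ᶠ f a) ×-dec (_ ≟ᵇ false) ×-dec (_ ≟ᵇ false)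

    sides-anticomplete : ∀ {s t} → s ∈ X₀ → t ∈ X₀ → Side s → ¬ Side t → s ≁ t
    sides-anticomplete _ t∈ (a , refl , a₁ , a₃) ¬side with ∈-comprehension⁻ in-image? t∈
    ... | 0F , refl = contradiction (0F , refl , refl , refl) ¬side
    ... | 1F , refl = trans (agree a 1F) a₁
    ... | 2F , refl = contradiction (2F , refl , refl , refl) ¬side
    ... | 3F , refl = trans (agree a 3F) a₃

    ¬side₁ : ¬ Side (f 1F)
    ¬side₁ (a , eq , _ , a₃) with () ←
      trans (sym (agree 1F 3F)) (trans (cong (λ v → adj v (f 3F)) eq) (trans (agree a 3F) a₃))

    start : 2 ≤ BigComponents.m (bigComponents X₀)
    start = BigComponents.separated⇒2≤m (bigComponents X₀) side? sides-anticomplete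
      (f∈X₀ 0F) (f∈X₀ 2F) (f∈X₀ 1F) (f∈X₀ 3F) (agree 0F 2F) (agree 1F 3F)
      (0F , refl , refl , refl) ¬side₁

    next : (a : ∃[ X ] Σ (BigComponents X) λ F → 2 ≤ BigComponents.m F) →
      Skeleton ⊎ ∃[ b ] proj₁ a ⊂ proj₁ b
    next (X , F , 2≤m) with any? (λ y → ¬? (y ∈? X) ×-dec any? (λ i →
        all? (λ a → (a ∈? BigComponents.K F i) →-dec (y ≁? a))))
    ... | no attached = inj₁ (X , F , 2≤m , λ {y} y∉X i → attach y y∉X i)
      where
      open BigComponents F
      attach : ∀ y → y ∉ X → ∀ i → ∃[ a ] (a ∈ K i × y ~ a)
      attach y y∉X i with any? (λ a → (a ∈? K i) ×-dec (y ~? a))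
      ... | yes nbr = nbr
      ... | no ∄nbr = ⊥-elim (attached (y , y∉X , i , λ a a∈ → ¬~⇒≁ λ ya → ∄nbr (a , a∈ , ya)))
    -- Adding a vertex anticomplete to `K i` leaves `K i` cut off from the rest, so an edge of `K i`
    -- and an edge of another `K j` still certify two big components.
    ... | yes (y , y∉X , i , yK) = inj₂ ((X′ , bigComponents X′ , 2≤m′) , old , y , q⊆p∪q X ⁅ y ⁆ (x∈⁅x⁆ y) , y∉X)
      where
      open BigComponents F
      X′ : Subset n
      X′ = X ∪ ⁅ y ⁆
      old : X ⊆ X′
      old = p⊆p∪q ⁅ y ⁆
      closed : ∀ {s t} → s ∈ X′ → t ∈ X′ → s ∈ K i → t ∉ K i → s ≁ t
      closed {s} _ t∈ s∈K t∉K with x∈p∪q⁻ X ⁅ y ⁆ t∈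
      ... | inj₁ t∈X = K-closed s∈K t∈X t∉K
      ... | inj₂ t∈y rewrite x∈⁅y⁆⇒x≡y y t∈y = ≁-sym (yK s s∈K)
      2≤m′ : 2 ≤ BigComponents.m (bigComponents X′)
      2≤m′ with another 2≤m i
      ... | j , i≢j with K-edge i | K-edge j
      ...   | a , b , a∈ , b∈ , ab | c , d , c∈ , d∈ , cd =
        BigComponents.separated⇒2≤m (bigComponents X′) (_∈? K i) closed
          (old (K⊆X a∈)) (old (K⊆X b∈)) (old (K⊆X c∈)) (old (K⊆X d∈)) ab cd a∈
          (λ c∈i → i≢j (K-disjoint c∈i c∈))

  -- How outside vertices attach to the big components.

  module Main
    (prime : Prime G) (p5 : P₅-free) (house : House-free) (c5 : C₅-free)
    {X : Subset n} (F : BigComponents X) (2≤m : 2 ≤ BigComponents.m F)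
    (attached : ∀ {y} → y ∉ X → ∀ i → ∃[ a ] (a ∈ BigComponents.K F i × y ~ a))
    where

    open BigComponents F

    -- The house again, now as the square a b c d with `e` on top of the edge ab, which is the shape
    -- in which most houses below arise.
    roof : ∀ {a b c d e} → a ~ b → b ~ c → c ~ d → d ~ a → a ≁ c → b ≁ d →
      e ~ a → e ~ b → e ≁ c → e ≁ d → ⊥
    roof ab bc cd da ac bd ea eb ec ed =
      house ac (~-sym ea) (~-sym da) ab (≁-sym ec) cd (~-sym bc) ed eb (≁-sym bd)

    -- Since `attached` supplies a neighbour, for a vertex outside `X` this amounts to being mixed
    -- on `K i`.
    Misses : Fin m → Fin n → Set
    Misses i y = ∃[ u ] (u ∈ K i × y ≁ u)

    misses? : ∀ i y → Dec (Misses i y)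
    misses? i y = any? λ u → (u ∈? K i) ×-dec (y ≁? u)

    ¬misses⇒complete : ∀ {i y} → ¬ Misses i y → CompleteTo G y (_∈ K i)
    ¬misses⇒complete ¬miss u u∈ = ¬≁⇒~ λ yu → ¬miss (u , u∈ , yu)

    split-edge : ∀ {i y} → y ∉ X → Misses i y →
      ∃[ a ] ∃[ b ] (a ∈ K i × b ∈ K i × a ~ b × y ~ a × y ≁ b)
    split-edge {i} {y} y∉ (u , u∈ , yu) with attached y∉ i
    ... | w , w∈ , yw with crossing (y ~?_) (K-connected w∈ u∈) yw (λ yu′ → ~⇒¬≁ yu′ yu)
    ...   | a , b , a∈ , b∈ , ab , ya , ¬yb = a , b , a∈ , b∈ , ab , ya , ¬~⇒≁ ¬yb

    -- With ab an edge of `K i` and cd an edge of `K j`, where `y` sees only `a` and `c`, the path b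
    -- a y c d is an induced P₅.
    misses-unique : ∀ {i j y} → y ∉ X → i ≢ j → Misses i y → ¬ Misses j y
    misses-unique y∉ i≢j miss miss′ with split-edge y∉ miss | split-edge y∉ miss′
    ... | a , b , a∈ , b∈ , ab , ya , yb | c , d , c∈ , d∈ , cd , yc , yd =
      p5 (~-sym ab) (≁-sym yb) (K-anticomplete i≢j b∈ c∈) (K-anticomplete i≢j b∈ d∈)
        (~-sym ya) (K-anticomplete i≢j a∈ c∈) (K-anticomplete i≢j a∈ d∈) yc yd cd

    complete-elsewhere : ∀ {i j y} → y ∉ X → i ≢ j → Misses i y → CompleteTo G y (_∈ K j)
    complete-elsewhere y∉ i≢j miss = ¬misses⇒complete (misses-unique y∉ i≢j miss)

    -- Take an edge cd of `K j` with `y′` adjacent to `c` only, and a neighbour `a` of `y` in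
    -- another `K i`, to which `y′` is complete. If `y` and `y′` were non-adjacent, c y a y′ would
    -- be a square with roof `d` on the edge cy.
    complete-~-misses : ∀ {j y y′} → y ∉ X → y′ ∉ X → CompleteTo G y (_∈ K j) → Misses j y′ → y ~ y′
    complete-~-misses {j} {y} {y′} y∉ y′∉ full miss with another 2≤m j | split-edge y′∉ miss
    ... | i , j≢i | c , d , c∈ , d∈ , cd , y′c , y′d with attached y∉ i
    ...   | a , a∈ , ya = ¬≁⇒~ λ yy′ →
      roof (~-sym (full c c∈)) ya (~-sym (complete-elsewhere y′∉ j≢i miss a a∈)) y′c
        (K-anticomplete j≢i c∈ a∈) yy′ (~-sym cd) (~-sym (full d d∈))
        (K-anticomplete j≢i d∈ a∈) (≁-sym y′d)

    -- By `dominated`, failure would give an induced path w p q in `K i` with `y` adjacent to `w`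
    -- only. Since `y` misses `K i`, it sees a vertex `c` of another component, and q p w y c is an
    -- induced P₅.
    neighbour-in-K : ∀ {i x y} → x ∈ K i → y ∉ X → x ≁ y → ∃[ v ] (v ∈ K i × v ~ x × y ~ v)
    neighbour-in-K {i} {x} {y} x∈ y∉ xy with another 2≤m i | attached y∉ i
    ... | j , i≢j | a , a∈ , ya with K-edge j
    ...   | c , _ , c∈ , _ = dominated (y ~?_) _~?_ bad (K-connected a∈ x∈) ya (λ yx → ~⇒¬≁ (~-sym yx) xy)
      where
      bad : ∀ {w p q} → w ∈ K i → p ∈ K i → q ∈ K i → w ~ p → p ~ q → ¬ w ~ q →
        y ~ w → ¬ y ~ p → ¬ y ~ q → ⊥
      bad w∈ p∈ q∈ wp pq ¬wq yw ¬yp ¬yq =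
        p5 (~-sym pq) (≁-sym (¬~⇒≁ ¬wq)) (≁-sym (¬~⇒≁ ¬yq)) (K-anticomplete i≢j q∈ c∈)
          (~-sym wp) (≁-sym (¬~⇒≁ ¬yp)) (K-anticomplete i≢j p∈ c∈) (~-sym yw)
          (K-anticomplete i≢j w∈ c∈) (complete-elsewhere y∉ i≢j (x , x∈ , ≁-sym xy) c c∈)

    -- Suppose `x` does not see `y′`. If `y` is complete to `K i`, then `complete-~-misses` makes
    -- `y` and `y′` adjacent. Otherwise take a common neighbour `v` of `x` and `y′` in `K i` and a
    -- common neighbour `c` of `y` and `y′` in `K j`: if `v` sees `y`, the square y v y′ c has roof
    -- `x`; if not, x y c y′ v is a C₅.
    K-unmixed : ∀ {i x y y′} → x ∈ K i → y ∉ X → y′ ∉ X → y ≁ y′ → x ~ y → x ~ y′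
    K-unmixed {i} {x} {y} {y′} x∈ y∉ y′∉ yy′ xy = ¬≁⇒~ absurd
      where
      absurd : ¬ x ≁ y′
      absurd xy′ with misses? i y | another 2≤m i | neighbour-in-K x∈ y′∉ xy′
      ... | no ¬miss | _ | _ =
        ~⇒¬≁ (complete-~-misses y∉ y′∉ (¬misses⇒complete ¬miss) (x , x∈ , ≁-sym xy′)) yy′
      ... | yes miss | j , i≢j | v , v∈ , vx , y′v with attached y′∉ j
      ...   | c , c∈ , y′c with complete-elsewhere y∉ i≢j miss c c∈ | v ~? y
      ...     | yc | yes vy =
        roof (~-sym vy) (~-sym y′v) y′c (~-sym yc) yy′ (K-anticomplete i≢j v∈ c∈)
          xy (~-sym vx) xy′ (K-anticomplete i≢j x∈ c∈)
      ...     | yc | no ¬vy =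
        c5 xy (K-anticomplete i≢j x∈ c∈) xy′ (~-sym vx) yc yy′ (≁-sym (¬~⇒≁ ¬vy))
          (~-sym y′c) (K-anticomplete (i≢j ∘ sym) c∈ v∈) y′v

    -- The partition into the sets X and Y, and properties (1), (2), (3) and (5).

    Isolated : Fin n → Set
    Isolated v = v ∈ X × (∀ w → w ∈ X → v ≁ w)

    isolated? : ∀ v → Dec (Isolated v)
    isolated? v = (v ∈? X) ×-dec all? (λ w → (w ∈? X) →-dec (v ≁? w))

    K-¬isolated : ∀ {i v} → v ∈ K i → ¬ Isolated v
    K-¬isolated v∈ (_ , iso) with K-neighbour v∈
    ... | w , w∈ , vw = ~⇒¬≁ vw (iso w (K⊆X w∈))

    IsY : Fin (suc m) → Fin n → Set
    IsY zero    v = v ∉ X × (∀ i → ¬ Misses i v)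
    IsY (suc i) v = v ∉ X × Misses i v

    isY? : ∀ i v → Dec (IsY i v)
    isY? zero    v = ¬? (v ∈? X) ×-dec all? (λ i → ¬? (misses? i v))
    isY? (suc i) v = ¬? (v ∈? X) ×-dec misses? i v

    Xs Ys : Fin (suc m) → Subset n
    Xs zero    = comprehension isolated?
    Xs (suc i) = K i
    Ys i       = comprehension (isY? i)

    X₀ : Fin n → Set
    X₀ v = v ∈ Xs zero

    isolated : ∀ {v} → X₀ v → Isolated v
    isolated = ∈-comprehension⁻ isolated?

    X₀⇒∈X : ∀ {v} → X₀ v → v ∈ X
    X₀⇒∈X = proj₁ ∘ isolated

    isY : ∀ i {v} → v ∈ Ys i → IsY i v
    isY i = ∈-comprehension⁻ (isY? i)

    Ys⇒∉X : ∀ i {v} → v ∈ Ys i → v ∉ X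
    Ys⇒∉X zero    = proj₁ ∘ isY zero
    Ys⇒∉X (suc i) = proj₁ ∘ isY (suc i)

    YS : Fin n → Set
    YS v = ∃[ i ] v ∈ Ys i

    YS? : ∀ v → Dec (YS v)
    YS? v = any? λ i → v ∈? Ys i

    YS⇒∉X : ∀ {v} → YS v → v ∉ X
    YS⇒∉X (i , v∈) = Ys⇒∉X i v∈

    ∉X⇒YS : ∀ {v} → v ∉ X → YS v
    ∉X⇒YS {v} v∉ with any? (λ i → misses? i v)
    ... | yes (i , miss) = suc i , ∈-comprehension⁺ (isY? (suc i)) (v∉ , miss)
    ... | no ∄miss = zero , ∈-comprehension⁺ (isY? zero) (v∉ , λ i miss → ∄miss (i , miss))

    Xs⊆X : ∀ i {v} → v ∈ Xs i → v ∈ X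
    Xs⊆X zero    = X₀⇒∈X
    Xs⊆X (suc i) = K⊆X

    X-cases : ∀ {v} → v ∈ X → X₀ v ⊎ ∃[ i ] v ∈ K i
    X-cases {v} v∈ with cover v v∈
    ... | inj₁ iso = inj₁ (∈-comprehension⁺ isolated? (v∈ , iso))
    ... | inj₂ v∈K = inj₂ v∈K

    -- For different indices, one of the two vertices is complete to a component that the other
    -- misses, so `complete-~-misses` applies.
    Ys-complete : ∀ i j → i ≢ j → SetComplete G (_∈ Ys i) (_∈ Ys j)
    Ys-complete zero zero i≢j = contradiction refl i≢j
    Ys-complete zero (suc j) _ v v∈ w w∈ with isY zero v∈ | isY (suc j) w∈
    ... | v∉ , full | w∉ , miss = complete-~-misses v∉ w∉ (¬misses⇒complete (full j)) miss
    Ys-complete (suc i) zero _ v v∈ w w∈ with isY (suc i) v∈ | isY zero w∈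
    ... | v∉ , miss | w∉ , full = ~-sym (complete-~-misses w∉ v∉ (¬misses⇒complete (full i)) miss)
    Ys-complete (suc i) (suc j) i≢j v v∈ w w∈ with isY (suc i) v∈ | isY (suc j) w∈
    ... | v∉ , miss | w∉ , miss′ =
      complete-~-misses v∉ w∉ (complete-elsewhere v∉ (i≢j ∘ cong suc) miss) miss′

    -- A vertex in two classes would be adjacent to itself by `Ys-complete`.
    Ys-disjoint : ∀ i j → i ≢ j → ∀ v → v ∈ Ys i → v ∉ Ys j
    Ys-disjoint i j i≢j v v∈i v∈j = ~⇒≢ (Ys-complete i j i≢j v v∈i v v∈j) refl

    Xs-anticomplete : ∀ i j → i ≢ j → SetAnticomplete G (_∈ Xs i) (_∈ Xs j)
    Xs-anticomplete zero    zero    i≢j = contradiction refl i≢j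
    Xs-anticomplete zero    (suc j) _   v v∈ w w∈ = proj₂ (isolated v∈) w (K⊆X w∈)
    Xs-anticomplete (suc i) zero    _   v v∈ w w∈ = ≁-sym (proj₂ (isolated w∈) v (K⊆X v∈))
    Xs-anticomplete (suc i) (suc j) i≢j v v∈ w w∈ = K-anticomplete (i≢j ∘ cong suc) v∈ w∈

    Xs-disjoint : ∀ i j → i ≢ j → ∀ v → v ∈ Xs i → v ∉ Xs j
    Xs-disjoint zero    zero    i≢j             = contradiction refl i≢j
    Xs-disjoint zero    (suc j) _   v v∈i v∈j = K-¬isolated v∈j (isolated v∈i)
    Xs-disjoint (suc i) zero    _   v v∈i v∈j = K-¬isolated v∈i (isolated v∈j)
    Xs-disjoint (suc i) (suc j) i≢j v v∈i v∈j = i≢j (cong suc (K-disjoint v∈i v∈j))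

    -- Otherwise every vertex outside `X` is complete to `K i` and every other vertex of `X`
    -- anticomplete to it, so `K i` is homogeneous; a vertex of another component shows that it is
    -- proper.
    Ys-nonempty : ∀ i → NonEmpty G (_∈ Ys (suc i))
    Ys-nonempty i with any? (_∈? Ys (suc i))
    ... | yes y = y
    ... | no ∄y = ⊥-elim (prime (K i) ((a , a∈) , uniform) (big i , c , λ c∈i → i≢j (K-disjoint c∈i c∈)))
      where
      j : Fin m
      j = proj₁ (another 2≤m i)
      i≢j : i ≢ j
      i≢j = proj₂ (another 2≤m i)
      a c : Fin n
      a = proj₁ (K-edge i)
      c = proj₁ (K-edge j)
      a∈ : a ∈ K i
      a∈ = proj₁ (proj₂ (proj₂ (K-edge i)))
      c∈ : c ∈ K j
      c∈ = proj₁ (proj₂ (proj₂ (K-edge j)))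
      uniform : ∀ v → v ∉ K i → CompleteTo G v (_∈ K i) ⊎ AnticompleteTo G v (_∈ K i)
      uniform v v∉ with v ∈? X
      ... | yes v∈X = inj₂ λ u u∈ → ≁-sym (K-closed u∈ v∈X v∉)
      ... | no v∉X = inj₁ (¬misses⇒complete λ miss → ∄y (v , ∈-comprehension⁺ (isY? (suc i)) (v∉X , miss)))

    -- If `x` misses `y`, take a neighbour `x′` of `x` in `K i` that sees `y`. Either its
    -- neighbourhood outside `X` is strictly larger, or some `y″` sees `x` but not `x′`. Then
    -- `K-unmixed` makes `y″` and `y` adjacent, and the square y″ y x′ x has as roof a vertex of
    -- another component.
    K-vertex-complete-to-Y : ∀ i → ∃[ v ] (v ∈ K i × CompleteTo G v YS)
    K-vertex-complete-to-Y i = climb nbrs next (proj₁ (K-edge i) , proj₁ (proj₂ (proj₂ (K-edge i))))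
      where
      nbr? : ∀ x y → Dec (y ∉ X × x ~ y)
      nbr? x y = ¬? (y ∈? X) ×-dec (x ~? y)
      nbrs : ∃[ x ] x ∈ K i → Subset n
      nbrs (x , _) = comprehension (nbr? x)
      next : (a : ∃[ x ] x ∈ K i) → (∃[ v ] (v ∈ K i × CompleteTo G v YS)) ⊎ ∃[ b ] nbrs a ⊂ nbrs b
      next (x , x∈) with any? (λ y → ¬? (y ∈? X) ×-dec (x ≁? y))
      ... | no ∄y = inj₁ (x , x∈ , λ y y∈ → ¬≁⇒~ λ xy → ∄y (y , YS⇒∉X y∈ , xy))
      ... | yes (y , y∉ , xy) with neighbour-in-K x∈ y∉ xy
      ...   | x′ , x′∈ , x′x , yx′ with any? (λ y″ → ¬? (y″ ∈? X) ×-dec (x ~? y″) ×-dec (x′ ≁? y″))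
      ...     | no ∄y″ = inj₂ ((x′ , x′∈) , grows , y
                , ∈-comprehension⁺ (nbr? x′) (y∉ , ~-sym yx′)
                , λ y∈ → ~⇒¬≁ (proj₂ (∈-comprehension⁻ (nbr? x) y∈)) xy)
        where
        grows : nbrs (x , x∈) ⊆ nbrs (x′ , x′∈)
        grows {z} z∈ with ∈-comprehension⁻ (nbr? x) z∈
        ... | z∉ , xz = ∈-comprehension⁺ (nbr? x′) (z∉ , ¬≁⇒~ λ x′z → ∄y″ (z , z∉ , xz , x′z))
      ...     | yes (y″ , y″∉ , xy″ , x′y″) with another 2≤m i
      ...       | j , i≢j with K-edge j
      ...         | c , _ , c∈ , _ = ⊥-elim
        (roof y″~y yx′ x′x xy″ (≁-sym x′y″) (≁-sym xy)
          (~-sym (complete-elsewhere y″∉ i≢j (x′ , x′∈ , ≁-sym x′y″) c c∈))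
          (~-sym (complete-elsewhere y∉ i≢j (x , x∈ , ≁-sym xy) c c∈))
          (K-anticomplete (i≢j ∘ sym) c∈ x′∈) (K-anticomplete (i≢j ∘ sym) c∈ x∈))
        where
        y″~y : y″ ~ y
        y″~y = ¬≁⇒~ λ y″y → ~⇒¬≁ (K-unmixed x∈ y″∉ y∉ y″y xy″) xy

    -- Anticomponents of Y and the vertices of X₀ mixed on them: (4), (6), (7) and (8).

    i₀ : Fin m
    i₀ = first 2≤m
      where
      first : ∀ {k} → 2 ≤ k → Fin k
      first (s≤s _) = zero

    -- c is the extra vertex that turns each forbidden four-vertex pattern between X₀ and Y into a
    -- five-vertex one: it sees all of Y and none of X₀.
    c : Fin n
    c = proj₁ (K-vertex-complete-to-Y i₀)

    c∈K : c ∈ K i₀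
    c∈K = proj₁ (proj₂ (K-vertex-complete-to-Y i₀))

    c~Y : ∀ {y} → YS y → c ~ y
    c~Y {y} = proj₂ (proj₂ (K-vertex-complete-to-Y i₀)) y

    X₀≁c : ∀ {x} → X₀ x → x ≁ c
    X₀≁c x∈ = proj₂ (isolated x∈) c (K⊆X c∈K)

    X₀-stable : ∀ {x x′} → X₀ x → X₀ x′ → x ≁ x′
    X₀-stable x∈ x′∈ = proj₂ (isolated x∈) _ (X₀⇒∈X x′∈)

    AC BigAC : Subset n → Set
    AC Z = Anticomponent G YS (_∈ Z)
    BigAC Z = AC Z × Big G (_∈ Z)

    XZ : Subset n → Fin n → Set
    XZ Z v = X₀ v × MixedOn G v (_∈ Z)

    XZ? : ∀ Z v → Dec (XZ Z v)
    XZ? Z v = (v ∈? Xs zero) ×-dec MixedOn? v Z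

    mixed-coedge : ∀ {v Z} → AC Z → MixedOn G v (_∈ Z) →
      ∃[ a ] ∃[ b ] (a ∈ Z × b ∈ Z × a ≁ b × v ~ a × v ≁ b)
    mixed-coedge {v} (_ , (_ , reach) , _) ((u , u∈ , vu) , w , w∈ , vw)
      with crossing (v ~?_) (reach u w u∈ w∈) vu (λ vw′ → ~⇒¬≁ vw′ vw)
    ... | a , b , a∈ , b∈ , (_ , ab) , va , ¬vb = a , b , a∈ , b∈ , ab , va , ¬~⇒≁ ¬vb

    AC-unique : ∀ {Z Z′ z} → AC Z → AC Z′ → z ∈ Z → z ∈ Z′ → Z ≡ Z′
    AC-unique ac ac′ = component-unique (anticomponent⇒component ac) (anticomponent⇒component ac′)

    AC-complete : ∀ {Z Z′} → AC Z → AC Z′ → Z ≢ Z′ → ∀ {z z′} → z ∈ Z → z′ ∈ Z′ → z ~ z′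
    AC-complete ac@(_ , _ , closed) ac′@(Z′⊆Y , _) Z≢Z′ {z} {z′} z∈ z′∈ =
      closed z z′ z∈ (Z′⊆Y z′ z′∈) λ z′∈Z → Z≢Z′ (AC-unique ac ac′ z′∈Z z′∈)

    K-¬mixed : ∀ {i v} → v ∈ K i → (Z : Subset n) → AC Z → ¬ MixedOn G v (_∈ Z)
    K-¬mixed v∈ Z ac@(Z⊆Y , _) mixed with mixed-coedge ac mixed
    ... | a , b , a∈ , b∈ , ab , va , vb =
      ~⇒¬≁ (K-unmixed v∈ (YS⇒∉X (Z⊆Y a a∈)) (YS⇒∉X (Z⊆Y b b∈)) ab va) vb

    -- Co-edges aa′ of `Z` and bb′ of `Z′`, with `v` adjacent to `a` and `b` only, form with `v` a
    -- house whose complement is the path a a′ v b′ b.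
    mixed-on-distinct : ∀ {v Z Z′} → AC Z → AC Z′ → Z ≢ Z′ →
      MixedOn G v (_∈ Z) → ¬ MixedOn G v (_∈ Z′)
    mixed-on-distinct ac ac′ Z≢Z′ mixed mixed′ with mixed-coedge ac mixed | mixed-coedge ac′ mixed′
    ... | a , a′ , a∈ , a′∈ , aa′ , va , va′ | b , b′ , b∈ , b′∈ , bb′ , vb , vb′ =
      house aa′ (~-sym va) (ZZ′ a∈ b′∈) (ZZ′ a∈ b∈) (≁-sym va′) (ZZ′ a′∈ b′∈) (ZZ′ a′∈ b∈)
        vb′ vb (≁-sym bb′)
      where
      ZZ′ = AC-complete ac ac′ Z≢Z′

    mixed-unique : ∀ v → X₀ v → (Z Z′ : Subset n) → AC Z → AC Z′ →
      MixedOn G v (_∈ Z) → MixedOn G v (_∈ Z′) → Z ≡ Z′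
    mixed-unique v _ Z Z′ ac ac′ mixed mixed′ with ≡-dec _≟ᵇ_ Z Z′
    ... | yes eq = eq
    ... | no Z≢Z′ = ⊥-elim (mixed-on-distinct ac ac′ Z≢Z′ mixed mixed′)

    -- Otherwise `Z` is homogeneous: the rest of Y is complete to it, and no vertex of `X` is mixed
    -- on it. It is proper because `c` lies outside.
    XZ-nonempty : (Z : Subset n) → BigAC Z → NonEmpty G (XZ Z)
    XZ-nonempty Z (ac@(Z⊆Y , (nonempty , _) , closed) , bigZ) with any? (XZ? Z)
    ... | yes v = v
    ... | no ∄v = ⊥-elim (prime Z (nonempty , uniform) (bigZ , c , λ c∈ → YS⇒∉X (Z⊆Y c c∈) (K⊆X c∈K)))
      where
      uniform : ∀ v → v ∉ Z → CompleteTo G v (_∈ Z) ⊎ AnticompleteTo G v (_∈ Z)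
      uniform v v∉ with v ∈? X
      ... | no v∉X = inj₁ λ u u∈ → ~-sym (closed u v u∈ (∉X⇒YS v∉X) v∉)
      ... | yes v∈X with X-cases v∈X
      ...   | inj₁ v∈X₀      = complete-or-anticomplete v Z λ mixed → ∄v (v , v∈X₀ , mixed)
      ...   | inj₂ (i , v∈K) = complete-or-anticomplete v Z (K-¬mixed v∈K Z ac)

    -- If `z` sees `x` in X_Z, pass to a non-neighbour `z′` of `z` in `Z` that does not see `x`.
    -- Either `z′` has strictly more non-neighbours in X_Z, or some `x′` sees `z′` but not `z`, and
    -- x z c z′ x′ is an induced P₅.
    anticomplete-to-XZ : (Z : Subset n) → BigAC Z → ∃[ z ] (z ∈ Z × AnticompleteTo G z (XZ Z))
    anticomplete-to-XZ Z (ac@(Z⊆Y , (nonempty , reach) , _) , _) = climb nonNbrs next nonempty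
      where
      nonNbr? : ∀ z x → Dec (XZ Z x × z ≁ x)
      nonNbr? z x = XZ? Z x ×-dec (z ≁? x)
      nonNbrs : NonEmpty G (_∈ Z) → Subset n
      nonNbrs (z , _) = comprehension (nonNbr? z)

      -- This is `dominated` in the complement: a bad co-path w p q extends to the co-path q p w x
      -- c, a house.
      co-neighbour : ∀ {z x} → z ∈ Z → XZ Z x → z ~ x → ∃[ w ] (w ∈ Z × CE G w z × x ≁ w)
      co-neighbour {z} {x} z∈ (x∈ , _ , w₀ , w₀∈ , xw₀) zx =
        dominated (x ≁?_) CE? bad (reach w₀ z w₀∈ z∈) xw₀ (~⇒¬≁ (~-sym zx))
        where
        bad : ∀ {w p q} → w ∈ Z → p ∈ Z → q ∈ Z → CE G w p → CE G p q → ¬ CE G w q →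
          x ≁ w → ¬ x ≁ p → ¬ x ≁ q → ⊥
        bad {w} {p} {q} w∈ p∈ q∈ (_ , wp) (_ , pq) ¬wq xw ¬xp ¬xq =
          house (≁-sym pq) (~-sym w~q) (~-sym (¬≁⇒~ ¬xq)) (~-sym (c~Y (Z⊆Y q q∈)))
            (≁-sym wp) (~-sym (¬≁⇒~ ¬xp)) (~-sym (c~Y (Z⊆Y p p∈)))
            (≁-sym xw) (~-sym (c~Y (Z⊆Y w w∈))) (X₀≁c x∈)
          where
          w~q : w ~ q
          -- Failure of `CE` alone would allow `w` and `q` to coincide; `x` tells them apart.
          w~q = ≢-¬CE⇒~ (separated⇒≢ (¬≁⇒~ ¬xq) xw ∘ sym) ¬wq

      next : (a : NonEmpty G (_∈ Z)) →
        (∃[ z ] (z ∈ Z × AnticompleteTo G z (XZ Z))) ⊎ ∃[ b ] nonNbrs a ⊂ nonNbrs b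
      next (z , z∈) with any? (λ x → XZ? Z x ×-dec (z ~? x))
      ... | no ∄x = inj₁ (z , z∈ , λ x x∈ → ¬~⇒≁ λ zx → ∄x (x , x∈ , zx))
      ... | yes (x , x∈ , zx) with co-neighbour z∈ x∈ zx
      ...   | z′ , z′∈ , (_ , z′z) , xz′ with any? (λ x′ → XZ? Z x′ ×-dec (z′ ~? x′) ×-dec (z ≁? x′))
      ...     | yes (x′ , x′∈ , z′x′ , zx′) = ⊥-elim
        (p5 (~-sym zx) (X₀≁c (proj₁ x∈)) xz′ (X₀-stable (proj₁ x∈) (proj₁ x′∈))
          (~-sym (c~Y (Z⊆Y z z∈))) (≁-sym z′z) zx′ (c~Y (Z⊆Y z′ z′∈))
          (≁-sym (X₀≁c (proj₁ x′∈))) z′x′)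
      ...     | no ∄x′ = inj₂ ((z′ , z′∈) , grows , x
                , ∈-comprehension⁺ (nonNbr? z′) (x∈ , ≁-sym xz′)
                , λ x∈N → ~⇒¬≁ zx (proj₂ (∈-comprehension⁻ (nonNbr? z) x∈N)))
        where
        grows : nonNbrs (z , z∈) ⊆ nonNbrs (z′ , z′∈)
        grows {x′} x′∈N with ∈-comprehension⁻ (nonNbr? z) x′∈N
        ... | x′∈ , zx′ = ∈-comprehension⁺ (nonNbr? z′) (x′∈ , ¬~⇒≁ λ z′x′ → ∄x′ (x′ , x′∈ , z′x′ , zx′))

    -- Domination between big anticomponents, and property (9).

    bigAC-of : ∀ {u w} → YS u → YS w → CE G u w → ∃[ Z ] (u ∈ Z × BigAC Z)
    bigAC-of {u} {w} u∈ w∈ uw with component CE-sym CE? YS? u u∈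
    ... | Z , u∈Z , isC@(_ , _ , closed) with w ∈? Z
    ...   | yes w∈Z = Z , u∈Z , component⇒anticomponent isC , u , w , proj₁ uw , u∈Z , w∈Z
    ...   | no w∉Z  = ⊥-elim (closed u w u∈Z w∈ w∉Z uw)

    -- Domination is recorded vertex by vertex, so that the vertices not dominated by `Z` form a
    -- subset on which `climb` can run.
    Dominates : Subset n → Fin n → Set
    Dominates Z w = YS w × w ∉ Z × ∃[ x ] (XZ Z x × x ~ w)

    dominates? : ∀ Z w → Dec (Dominates Z w)
    dominates? Z w = YS? w ×-dec ¬? (w ∈? Z) ×-dec any? (λ x → XZ? Z x ×-dec (x ~? w))

    module _ {Z Z′ x z′} (ac : AC Z) (ac′ : AC Z′) (x∈ : XZ Z x) (z′∈ : z′ ∈ Z′) (z′∉Z : z′ ∉ Z) (xz′ : x ~ z′)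
      where

      private
        Z≢Z′ : Z ≢ Z′
        Z≢Z′ refl = z′∉Z z′∈

      x-complete : CompleteTo G x (_∈ Z′)
      x-complete with complete-or-anticomplete x Z′ (mixed-on-distinct ac ac′ Z≢Z′ (proj₂ x∈))
      ... | inj₁ complete = complete
      ... | inj₂ anti     = ⊥-elim (~⇒¬≁ xz′ (anti z′ z′∈))

      -- Let ab be a co-edge of `Z′` with `x′` adjacent to `a` only. Both `x` and `w` are complete
      -- to `Z′`, so if `x` missed `w` the co-path a b x′ x w would be a house.
      x-inherits : ∀ {x′ w} → XZ Z′ x′ → YS w → w ∉ Z′ → x′ ~ w → x ~ w
      x-inherits {x′} {w} (x′∈ , mixed) w∈ w∉ x′w with mixed-coedge ac′ mixed
      ... | a , b , a∈ , b∈ , ab , x′a , x′b = ¬≁⇒~ λ xw →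
        house ab (~-sym x′a) (~-sym (x-complete a a∈)) (Z′~w a∈)
          (≁-sym x′b) (~-sym (x-complete b b∈)) (Z′~w b∈)
          (X₀-stable x′∈ (proj₁ x∈)) x′w xw
        where
        Z′~w : ∀ {z} → z ∈ Z′ → z ~ w
        Z′~w {z} z∈ = proj₂ (proj₂ ac′) z w z∈ w∈ w∉

      -- The point is that `w` lies outside `Z`. Otherwise `x′`, not being mixed on `Z`, is complete
      -- to it, and `x` inherits all these neighbours, although it has a non-neighbour in `Z`.
      Dominates-transitive : ∀ {w} → Dominates Z′ w → Dominates Z w
      Dominates-transitive {w} (w∈ , w∉Z′ , x′ , x′∈ , x′w) =
        w∈ , w∉Z , x , x∈ , x-inherits x′∈ w∈ w∉Z′ x′w
        where
        w∉Z : w ∉ Z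
        w∉Z w∈Z with complete-or-anticomplete x′ Z (mixed-on-distinct ac′ ac (Z≢Z′ ∘ sym) (proj₂ x′∈))
        ... | inj₂ anti = ~⇒¬≁ x′w (anti w w∈Z)
        ... | inj₁ complete with proj₂ (proj₂ x∈)
        ...   | w₀ , w₀∈ , xw₀ = ~⇒¬≁
          (x-inherits x′∈ (proj₁ ac w₀ w₀∈) (λ w₀∈Z′ → Z≢Z′ (AC-unique ac ac′ w₀∈ w₀∈Z′)) (complete w₀ w₀∈)) xw₀

    Terminal : Subset n → Set
    Terminal Z = BigAC Z × ((Z′ : Subset n) →
      Anticomponent G (λ v → YS v × v ∉ Z) (_∈ Z′) × Big G (_∈ Z′) → SetAnticomplete G (XZ Z) (_∈ Z′))

    terminal : ¬ Clique G YS → ∃ Terminal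
    terminal ¬clique with any? (λ u → any? (λ w → YS? u ×-dec YS? w ×-dec CE? u w))
    ... | no ∄coedge = ⊥-elim (¬clique λ u w u∈ w∈ u≢w → ¬≁⇒~ λ uw → ∄coedge (u , w , u∈ , w∈ , u≢w , uw))
    ... | yes (u , w , u∈ , w∈ , uw) with bigAC-of u∈ w∈ uw
    ...   | Z₀ , _ , bigZ₀ = climb undominated next (Z₀ , bigZ₀)
      where
      undominated : ∃ BigAC → Subset n
      undominated (Z , _) = comprehension (λ w → ¬? (dominates? Z w))

      next : (a : ∃ BigAC) → ∃ Terminal ⊎ ∃[ b ] undominated a ⊂ undominated b
      next (Z , bigZ) with any? (λ z′ → dominates? Z z′ ×-dec any? (λ w → YS? w ×-dec CE? z′ w))
      -- In a big anticomponent of the rest of Y every vertex has a non-neighbour in Y, so a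
      -- neighbour of X_Z there would have been found by the search.
      ... | no ∄z′ = inj₁ (Z , bigZ , anticomplete)
        where
        anticomplete : ∀ Z′ → Anticomponent G (λ v → YS v × v ∉ Z) (_∈ Z′) × Big G (_∈ Z′) →
          SetAnticomplete G (XZ Z) (_∈ Z′)
        anticomplete Z′ ((Z′⊆ , (_ , reach) , _) , big-Z′) x x∈ z′ z′∈
          with big-connected⇒neighbour big-Z′ reach z′∈
        ... | w , w∈ , z′w = ¬~⇒≁ λ xz′ → ∄z′
          (z′ , (proj₁ (Z′⊆ z′ z′∈) , proj₂ (Z′⊆ z′ z′∈) , x , x∈ , xz′) , w , proj₁ (Z′⊆ w w∈) , z′w)
      ... | yes (z′ , dom@(z′∈Y , z′∉Z , x , x∈ , xz′) , w , w∈Y , z′w) with bigAC-of z′∈Y w∈Y z′w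
      -- Growth is strict at `z′`: `Z` dominates it, while `Z′` contains it and so does not.
      ...   | Z′ , z′∈Z′ , bigZ′ = inj₂ ((Z′ , bigZ′) , grows , z′
              , ∈-comprehension⁺ (λ w → ¬? (dominates? Z′ w)) (λ dom′ → proj₁ (proj₂ dom′) z′∈Z′)
              , λ z′∈N → ∈-comprehension⁻ (λ w → ¬? (dominates? Z w)) z′∈N dom)
        where
        grows : undominated (Z , bigZ) ⊆ undominated (Z′ , bigZ′)
        grows v∈ = ∈-comprehension⁺ (λ w → ¬? (dominates? Z′ w)) λ dom′ →
          ∈-comprehension⁻ (λ w → ¬? (dominates? Z w)) v∈
            (Dominates-transitive (proj₁ bigZ) (proj₁ bigZ′) x∈ z′∈Z′ z′∉Z xz′ dom′)

    -- Assembling the nine properties.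

    structure : Structure G m Xs Ys
    structure = record
      { disjX     = Xs-disjoint
      ; disjY     = Ys-disjoint
      ; disjXY    = λ i j v v∈X v∈Y → Ys⇒∉X j v∈Y (Xs⊆X i v∈X)
      ; cover     = covered
      ; c1-conn   = λ i → proj₁ (proj₂ (isComponent i))
      ; c1-big    = big
      ; c1-stable = λ u v u∈ v∈ → X₀-stable u∈ v∈
      ; c1-anti   = Xs-anticomplete
      ; c2-ne     = Ys-nonempty
      ; c2-mixed  = λ i y y∈ → attached (Ys⇒∉X (suc i) y∈) i , proj₂ (isY (suc i) y∈)
      ; c2-comp   = Y-complete
      ; c2-Y0     = Y₀-complete
      ; c3        = Ys-complete
      ; c4        = unmixed
      ; c5        = K-vertex-complete-to-Y
      ; c6        = mixed-unique
      ; c7-ne     = XZ-nonempty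
      ; c7-disj   = λ Z Z′ (ac , _) (ac′ , _) Z≢Z′ v (_ , mixed) (_ , mixed′) →
                      mixed-on-distinct ac ac′ Z≢Z′ mixed mixed′
      ; c8        = anticomplete-to-XZ
      ; c9        = terminal
      }
      where
      XS : Fin n → Set
      XS v = ∃[ i ] v ∈ Xs i

      covered : ∀ v → XS v ⊎ YS v
      covered v with v ∈? X
      ... | no v∉ = inj₂ (∉X⇒YS v∉)
      ... | yes v∈ with X-cases v∈
      ...   | inj₁ v∈X₀      = inj₁ (zero , v∈X₀)
      ...   | inj₂ (i , v∈K) = inj₁ (suc i , v∈K)

      Y-complete : ∀ i y → y ∈ Ys (suc i) → CompleteTo G y (λ v → XS v × ¬ v ∈ K i × ¬ X₀ v)
      Y-complete i y y∈ v ((zero , v∈) , _ , v∉X₀) = contradiction v∈ v∉X₀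
      Y-complete i y y∈ v ((suc j , v∈) , v∉K , _) with isY (suc i) y∈
      ... | y∉ , miss = complete-elsewhere y∉ (λ { refl → v∉K v∈ }) miss v v∈

      Y₀-complete : ∀ y → y ∈ Ys zero → CompleteTo G y (λ v → XS v × ¬ X₀ v)
      Y₀-complete y y∈ v ((zero , v∈) , v∉X₀) = contradiction v∈ v∉X₀
      Y₀-complete y y∈ v ((suc j , v∈) , _)   = ¬misses⇒complete (proj₂ (isY zero y∈) j) v v∈

      unmixed : ∀ v → XS v → ¬ X₀ v → (Z : Subset n) → AC Z → ¬ MixedOn G v (_∈ Z)
      unmixed v (zero , v∈)  v∉X₀ = contradiction v∈ v∉X₀
      unmixed v (suc i , v∈) _    = K-¬mixed v∈

theorem2p3 : (G : Graph) → Prime G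
    → ¬ ContainsInduced G (pathAdj 5)
    → ¬ ContainsInduced G (complAdj (pathAdj 5))
    → ¬ ContainsInduced G (cycleAdj 5)
    → ContainsInduced G (complAdj (cycleAdj 4))
    → ∃[ m ] (2 ≤ m × Σ (Fin (suc m) → Subset (Graph.n G)) λ X →
    Σ (Fin (suc m) → Subset (Graph.n G)) λ Y → Structure G m X Y)
theorem2p3 G prime noP₅ noHouse noC₅ 2K₂ with skeleton G 2K₂
... | X , F , 2≤m , attached = BigComponents.m F , 2≤m , Xs , Ys , structure
  where
  open Main G prime (p₅-free G noP₅) (house-free G noHouse) (c₅-free G noC₅) F 2≤m attached
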